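{- Let $n>k\geqslant 1$ be integers and let $\sigma\in S_n$. Then $\sigma$ is $k$-prolific if and only if $\mathrm{br}(\sigma)\geqslant k+2$.
   Context: $S_n$ is the set of permutations of $[n]=\{1,\dots,n\}$, written in one-line notation $\sigma=\sigma(1)\cdots\sigma(n)$. A permutation $\sigma\in S_n$ contains $\pi\in S_r$ (written $\pi\preceq\sigma$) if there are indices $i_1<\dots<i_r$ with $\sigma(i_1)\cdots\sigma(i_r)$ in the same relative order as $\pi$. For $n>k\geqslant1$, $\sigma\in S_n$ is $k$-prolific if $|\{\pi\in S_{n-k}:\pi\preceq\sigma\}|=\binom{n}{k}$. The distance between entries $i,j$ of $\sigma$ is $d_\sigma(i,j)=|i-j|+|\sigma(i)-\sigma(j)|$ (the $L_1$ distance between the points $(i,\sigma(i))$ and $(j,\sigma(j))$), and for $n>1$ the breadth of $\sigma$ is $\mathrm{br}(\sigma)=\min_{i\neq j} d_\sigma(i,j)$. -}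

module Defs where

open import Data.Nat using (ℕ; suc; _+_; _*_; _∸_; _⊓_; ∣_-_∣)
open import Data.Fin using (Fin; toℕ; _<?_) renaming (_<_ to _<ᶠ_)
open import Relation.Nullary using (yes; no)
open import Data.Vec using (Vec; lookup)
open import Data.List using (List; []; _∷_; length; foldr; map; concatMap; allFin)
open import Data.List.Relation.Unary.Unique.Propositional using (Unique)
open import Data.List.Membership.Propositional using (_∈_)
open import Data.Product using (Σ; ∃; _×_; _,_)
open import Relation.Binary.PropositionalEquality using (_≡_)
open import Function.Bundles using (_⇔_)
open import Data.Nat.Combinatorics using (_C_)

-- A permutation of [n] in one-line notation: a vector of length n with
-- entries in Fin n (values 0..n-1 stand for 1..n) that is injective,
-- hence a bijection of Fin n.
IsPerm : ∀ {n} → Vec (Fin n) n → Set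
IsPerm {n} v = ∀ (i j : Fin n) → lookup v i ≡ lookup v j → i ≡ j

_≼_ : ∀ {r n} → Vec (Fin r) r → Vec (Fin n) n → Set
_≼_ {r} {n} π σ =
  Σ (Fin r → Fin n) λ e →
    (∀ a b → a <ᶠ b → e a <ᶠ e b) ×
    (∀ a b → (lookup π a <ᶠ lookup π b) ⇔ (lookup σ (e a) <ᶠ lookup σ (e b)))

NumPatterns : ∀ {n} → (m : ℕ) → Vec (Fin n) n → ℕ → Set
NumPatterns {n} m σ N =
  Σ (List (Vec (Fin m) m)) λ L →
    Unique L ×
    (∀ π → (π ∈ L) ⇔ (IsPerm π × (π ≼ σ))) ×
    length L ≡ N

Prolific : ∀ {n} → (k : ℕ) → Vec (Fin n) n → Set
Prolific {n} k σ = NumPatterns (n ∸ k) σ (n C k)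

dist : ∀ {n} → Vec (Fin n) n → Fin n → Fin n → ℕ
dist σ i j = ∣ toℕ i - toℕ j ∣ + ∣ toℕ (lookup σ i) - toℕ (lookup σ j) ∣

-- Breadth: minimum of dist σ i j over ordered pairs i ≠ j (equivalently
-- pairs i < j, dist being symmetric).  The fold starts at 2n, which
-- exceeds every distance (each is ≤ 2(n-1)), so for n > 1 this is exactly
-- the minimum.
br : ∀ {n} → Vec (Fin n) n → ℕ
br {n} σ =
  foldr _⊓_ (2 * n)
    (concatMap (λ i → concatMap (λ j → pairDist i j) (allFin n)) (allFin n))
  where
    pairDist : Fin n → Fin n → List ℕ
    pairDist i j with i <? j
    ... | yes _ = dist σ i j ∷ []
    ... | no _ = []

{-# OPTIONS --safe #-}

-- Write m = n ∸ k.  If two entries i, j are at distance at most k + 1, then at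
-- most k ∸ 1 other entries lie between them horizontally or vertically; keeping
-- m ∸ 1 entries away from those, together with i or with j, gives the same
-- pattern twice.
--
-- Conversely, let e ≠ e′ be two embeddings of one pattern.  The partial map
-- e a ↦ e′ a preserves both orders, so its orbits are fixed points and k chains,
-- each starting outside the image of e′ and monotone in both coordinates.  By
-- symmetry some step goes right and up.  A vertical or horizontal strip between
-- e a and e′ a contains at most one entry of each chain, so a pair of points is
-- at distance at most k + 1 once no chain meets both of its strips.  To find
-- such a pair, choose heights in each coordinate on which ascending steps act
-- as translation by a constant, and take the ascending step starting at c of least
-- total height: either c and a point of the rectangle of its step will do, or
-- else c and the start of another chain to its upper left or lower right.

module Submission where

open import Defs
open import Data.Nat
open import Data.Nat.Properties hiding (suc-injective; 0≢1+n)
open import Algebra.Properties.CommutativeSemigroup +-commutativeSemigroup using (xy∙z≈xz∙y; x∙yz≈xz∙y)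
open import Data.Nat.Combinatorics using (_C_; nCk+nC[k+1]≡[n+1]C[k+1]; nCk≡nC[n∸k])
open import Data.Nat.Induction using (<-wellFounded)
open import Induction.WellFounded using (Acc; acc)
open import Data.Fin using (Fin; zero; suc; toℕ; fromℕ<; splitAt; join) renaming (_<_ to _<ᶠ_)
open import Data.Fin.Properties using (any?; 0≢1+n; suc-injective; toℕ<n; toℕ-injective; toℕ-fromℕ<; fromℕ<-injective; injective⇒≤; join-splitAt) renaming (_≟_ to _≟ᶠ_; _<?_ to _<?ᶠ_; <-cmp to <ᶠ-cmp)
open import Data.List using (List; []; _∷_; _++_; length; map; foldr; concatMap; allFin) renaming (lookup to lookupˡ)
open import Data.List.Properties using (length-map; length-++)
open import Data.List.Membership.Propositional using (_∈_)
open import Data.List.Membership.Propositional.Properties using (∈-map⁺; ∈-map⁻; ∈-++⁺ˡ; ∈-++⁺ʳ; ∈-lookup)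
open import Data.List.Relation.Unary.All as All using (All; []; _∷_)
import Data.List.Relation.Unary.All.Properties as All
open import Data.List.Relation.Unary.AllPairs using ([]; _∷_)
open import Data.List.Relation.Unary.Any using (here; index)
open import Data.List.Relation.Unary.Any.Properties using (lookup-result)
open import Data.List.Relation.Unary.Unique.Propositional using (Unique)
import Data.List.Relation.Unary.Unique.Propositional.Properties as Unique
open import Data.Vec using (Vec; lookup; tabulate)
open import Data.Vec.Properties using (lookup∘tabulate; tabulate-cong; tabulate∘lookup)
open import Data.Product using (Σ; ∃; ∃-syntax; _×_; _,_; proj₁; proj₂)
open import Data.Sum using (_⊎_; inj₁; inj₂; [_,_]′)
open import Data.Empty using (⊥)
open import Data.Unit using (⊤; tt)
open import Function using (_∘_)
open import Function.Bundles using (_⇔_; mk⇔; Equivalence)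
open import Function.Definitions using (Injective)
open import Relation.Nullary using (¬_; Dec; yes; no; contradiction)
open import Relation.Nullary.Decidable using (_×-dec_; _⊎-dec_; ¬?)
open import Relation.Binary using (tri<; tri≈; tri>)
open import Relation.Binary.PropositionalEquality

open Equivalence using (to; from)

-- A height function for a partial shift of the line

-- The partial map f a ↦ g a is increasing; u conjugates its rightward part to
-- translation by N.  Positions are treated from left to right: an image
-- position is forced, any other one is placed half a gap above its
-- predecessor, so after position p all gaps are still at least 2 ^ (n ∸ p).
module Abel {m : ℕ} (f g : Fin m → ℕ) (n : ℕ)
  (f<⇒g< : ∀ a b → f a < f b → g a < g b)
  (g<⇒f< : ∀ a b → g a < g b → f a < f b) where

  N : ℕ
  N = 2 ^ n

  -- room keeps the forced values of images still to come above everything placed so far.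
  record Partial (p h : ℕ) (u : ℕ → ℕ) : Set where
    field
      increasing : ∀ {i j} → i < j → j ≤ p → u i + h ≤ u j
      translates : ∀ a → f a < g a → g a ≤ p → u (g a) ≡ u (f a) + N
      room : ∀ a → f a ≤ p → p < g a → u p + h ≤ u (f a) + N

  extend : ℕ → ℕ → (ℕ → ℕ) → ℕ → ℕ
  extend p v u i with i ≤? p
  ... | yes _ = u i
  ... | no _ = v

  extend-old : ∀ {p v u i} → i ≤ p → extend p v u i ≡ u i
  extend-old {p} {v} {u} {i} i≤p with i ≤? p
  ... | yes _ = refl
  ... | no i≰p = contradiction i≤p i≰p

  extend-new : ∀ {p v u} → extend p v u (suc p) ≡ v
  extend-new {p} with suc p ≤? p
  ... | yes p<p = contradiction p<p 1+n≰n
  ... | no _ = refl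

  -- The last two hypotheses are what `translates` and `room` demand of the new position; `h ≤ N`
  -- gives `room` to a step that starts there.
  extend-partial : ∀ {p h h′ u v} → Partial p h′ u → h ≤ h′ → h ≤ N → u p + h ≤ v →
    (∀ a → f a < g a → g a ≡ suc p → v ≡ u (f a) + N) →
    (∀ a → f a ≤ p → suc p < g a → v + h ≤ u (f a) + N) →
    Partial (suc p) h (extend p v u)
  extend-partial {p} {h} {h′} {u} {v} U h≤h′ h≤N up+h≤v onto below = record
    { increasing = incr ; translates = trsl ; room = rm }
    where
    open Partial U
    w = extend p v u

    u≤up : ∀ {i} → i ≤ p → u i ≤ u p
    u≤up {i} i≤p with m≤n⇒m<n∨m≡n i≤p
    ... | inj₁ i<p = ≤-trans (m≤m+n (u i) h′) (increasing i<p ≤-refl)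
    ... | inj₂ refl = ≤-refl

    incr : ∀ {i j} → i < j → j ≤ suc p → w i + h ≤ w j
    incr {i} {j} i<j j≤1+p with m≤n⇒m<n∨m≡n j≤1+p
    ... | inj₁ (s≤s j≤p) rewrite extend-old {p} {v} {u} j≤p | extend-old {p} {v} {u} (≤-trans (<⇒≤ i<j) j≤p)
      = ≤-trans (+-monoʳ-≤ (u i) h≤h′) (increasing i<j j≤p)
    ... | inj₂ refl rewrite extend-new {p} {v} {u} | extend-old {p} {v} {u} (s≤s⁻¹ i<j)
      = ≤-trans (+-monoˡ-≤ h (u≤up (s≤s⁻¹ i<j))) up+h≤v

    trsl : ∀ a → f a < g a → g a ≤ suc p → w (g a) ≡ w (f a) + N
    trsl a fa<ga ga≤1+p
      rewrite extend-old {p} {v} {u} (s≤s⁻¹ (<-≤-trans fa<ga ga≤1+p)) with m≤n⇒m<n∨m≡n ga≤1+p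
    ... | inj₁ (s≤s ga≤p) = trans (extend-old ga≤p) (translates a fa<ga ga≤p)
    ... | inj₂ ga≡1+p = trans (cong w ga≡1+p) (trans (extend-new {p} {v} {u}) (onto a fa<ga ga≡1+p))

    rm : ∀ a → f a ≤ suc p → suc p < g a → w (suc p) + h ≤ w (f a) + N
    rm a fa≤1+p 1+p<ga with m≤n⇒m<n∨m≡n fa≤1+p
    ... | inj₂ fa≡1+p rewrite fa≡1+p = +-monoʳ-≤ (w (suc p)) h≤N
    ... | inj₁ (s≤s fa≤p) rewrite extend-old {p} {v} {u} fa≤p | extend-new {p} {v} {u} = below a fa≤p 1+p<ga

  g≡⇒f≡ : ∀ a b → g a ≡ g b → f a ≡ f b
  g≡⇒f≡ a b ga≡gb with <-cmp (f a) (f b)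
  ... | tri< fa<fb _ _ = contradiction ga≡gb (<⇒≢ (f<⇒g< a b fa<fb))
  ... | tri≈ _ fa≡fb _ = fa≡fb
  ... | tri> _ _ fb<fa = contradiction (sym ga≡gb) (<⇒≢ (f<⇒g< b a fb<fa))

  next : ∀ {p h u} → Partial p (h + h) u → h ≤ N → ∃ (Partial (suc p) h)
  next {p} {h} {u} U h≤N with any? (λ a → (f a <? g a) ×-dec (g a ≟ suc p))
  -- The new position is an image, so its height is forced; `room` at `a` provides the gap below it.
  ... | yes (a , fa<ga , ga≡1+p) = _ , extend-partial U (m≤m+n h h) h≤N
          (≤-trans (+-monoʳ-≤ (u p) (m≤m+n h h)) (room a fa≤p (≤-reflexive (sym ga≡1+p))))
          (λ b _ gb≡1+p → cong (λ i → u i + N) (g≡⇒f≡ a b (trans ga≡1+p (sym gb≡1+p))))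
          below
    where
    open Partial U
    fa≤p : f a ≤ p
    fa≤p = s≤s⁻¹ (subst (f a <_) ga≡1+p fa<ga)
    -- A later image `g b` comes from some `f b` right of `f a`, and the gap between these two
    -- sources is the room required.
    below : ∀ b → f b ≤ p → suc p < g b → u (f a) + N + h ≤ u (f b) + N
    below b fb≤p 1+p<gb = begin
      u (f a) + N + h   ≡⟨ +-assoc (u (f a)) N h ⟩
      u (f a) + (N + h) ≡⟨ cong (u (f a) +_) (+-comm N h) ⟩
      u (f a) + (h + N) ≡⟨ +-assoc (u (f a)) h N ⟨
      u (f a) + h + N   ≤⟨ +-monoˡ-≤ N (+-monoʳ-≤ (u (f a)) (m≤m+n h h)) ⟩
      u (f a) + (h + h) + N ≤⟨ +-monoˡ-≤ N (increasing (g<⇒f< a b (subst (_< g b) (sym ga≡1+p) 1+p<gb)) fb≤p) ⟩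
      u (f b) + N       ∎
      where open ≤-Reasoning
  -- Half of the old gap `h + h` separates the new position from `p`; the other half remains as
  -- room.
  ... | no ∄a = _ , extend-partial U (m≤m+n h h) h≤N ≤-refl
          (λ a fa<ga ga≡1+p → contradiction (a , fa<ga , ga≡1+p) ∄a)
          (λ a fa≤p 1+p<ga → ≤-trans (≤-reflexive (+-assoc (u p) h h)) (Partial.room U a fa≤p (<⇒≤ 1+p<ga)))

  build : ∀ p q → p + q ≡ n → ∃ (Partial p (2 ^ q))
  -- Position 0 starts with the full gap `N`; each of the `n` later ones halves it, which leaves gap
  -- 1 at the end.
  build zero q refl = (λ _ → 0) , record
    { increasing = λ { () z≤n } ; translates = λ _ fa<ga ga≤0 → contradiction (≤-trans fa<ga ga≤0) λ () ; room = λ _ _ _ → ≤-refl }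
  build (suc p) q eq with build p (suc q) (trans (+-suc p q) eq)
  ... | u , U = next (subst (λ h → Partial p h u) (cong (2 ^ q +_) (+-identityʳ (2 ^ q))) U)
                     (^-monoʳ-≤ 2 (≤-trans (m≤n+m q (suc p)) (≤-reflexive eq)))

  abel : Σ (ℕ → ℕ) λ u → (∀ {i j} → i < j → j ≤ n → u i < u j) ×
                         (∀ a → f a < g a → g a ≤ n → u (g a) ≡ u (f a) + N)
  abel with build n 0 (+-identityʳ n)
  ... | u , U = u , (λ {i} i<j j≤n → ≤-trans (≤-reflexive (+-comm 1 (u i))) (increasing i<j j≤n)) , translates
    where open Partial U

-- For pigeonhole arguments: disjoint families in `Fin n` are glued, so that their sizes add up to
-- at most `n`.
disjoint-⊎ : ∀ {a b n} (f : Fin a → Fin n) (g : Fin b → Fin n) →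
  Injective _≡_ _≡_ f → Injective _≡_ _≡_ g → (∀ i j → f i ≢ g j) →
  Injective _≡_ _≡_ ([ f , g ]′ ∘ splitAt a)
disjoint-⊎ {a} {b} f g f-inj g-inj f≢g {x} {y} eq =
  trans (sym (join-splitAt a b x)) (trans (cong (join a b) (go (splitAt a x) (splitAt a y) eq)) (join-splitAt a b y))
  where
  go : ∀ s t → [ f , g ]′ s ≡ [ f , g ]′ t → s ≡ t
  go (inj₁ i) (inj₁ j) eq = cong inj₁ (f-inj eq)
  go (inj₁ i) (inj₂ j) eq = contradiction eq (f≢g i j)
  go (inj₂ i) (inj₁ j) eq = contradiction (sym eq) (f≢g j i)
  go (inj₂ i) (inj₂ j) eq = cong inj₂ (g-inj eq)

-- Chains of the partial map e a ↦ e′ a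

-- An axis of the plot, kept abstract so that rows, columns, reversed axes and the exchange of `e`
-- and `e′` share one argument.
record Coordinate {n m : ℕ} (e e′ : Fin m → Fin n) : Set where
  field
    pos : Fin n → ℕ
    pos-injective : ∀ {x y} → pos x ≡ pos y → x ≡ y
    pos<n : ∀ x → pos x < n
    pos-surjective : ∀ i → i < n → ∃[ x ] pos x ≡ i
    preserves : ∀ a b → pos (e a) < pos (e b) → pos (e′ a) < pos (e′ b)
    reflects : ∀ a b → pos (e′ a) < pos (e′ b) → pos (e a) < pos (e b)

module _ {n m : ℕ} {e e′ : Fin m → Fin n} where

  -- A segment of an orbit of the partial map `e b ↦ e′ b`.
  data Chain : Fin n → Fin n → Set where
    [] : ∀ {z} → Chain z z
    step : ∀ {s z} b → s ≡ e b → Chain (e′ b) z → Chain s z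

  module Line (X : Coordinate e e′) where
    open Coordinate X public

    private
      module U = Abel (pos ∘ e) (pos ∘ e′) n preserves reflects

    e≡⇒e′≡ : ∀ {a b} → e a ≡ e b → e′ a ≡ e′ b
    e≡⇒e′≡ {a} {b} eq with <-cmp (pos (e′ a)) (pos (e′ b))
    ... | tri< lt _ _ = contradiction (cong pos eq) (<⇒≢ (reflects a b lt))
    ... | tri≈ _ eq′ _ = pos-injective eq′
    ... | tri> _ _ gt = contradiction (cong pos (sym eq)) (<⇒≢ (reflects b a gt))

    e′≡⇒e≡ : ∀ {a b} → e′ a ≡ e′ b → e a ≡ e b
    e′≡⇒e≡ {a} {b} eq with <-cmp (pos (e a)) (pos (e b))
    ... | tri< lt _ _ = contradiction (cong pos eq) (<⇒≢ (preserves a b lt))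
    ... | tri≈ _ eq′ _ = pos-injective eq′
    ... | tri> _ _ gt = contradiction (cong pos (sym eq)) (<⇒≢ (preserves b a gt))

    height : Fin n → ℕ
    height x = proj₁ U.abel (pos x)

    height-mono : ∀ {x y} → pos x < pos y → height x < height y
    height-mono {y = y} lt = proj₁ (proj₂ U.abel) lt (<⇒≤ (pos<n y))

    height-mono-≤ : ∀ {x y} → pos x ≤ pos y → height x ≤ height y
    height-mono-≤ {x} {y} le with m≤n⇒m<n∨m≡n le
    ... | inj₁ lt = <⇒≤ (height-mono lt)
    ... | inj₂ eq = ≤-reflexive (cong height (pos-injective eq))

    height-reflects : ∀ {x y} → height x < height y → pos x < pos y
    height-reflects lt = ≰⇒> λ ge → <⇒≱ lt (height-mono-≤ ge)

    Ascends : Fin m → Set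
    Ascends a = pos (e a) < pos (e′ a)

    height-shift : ∀ {a} → Ascends a → height (e′ a) ≡ height (e a) + 2 ^ n
    height-shift {a} up = proj₂ (proj₂ U.abel) a up (<⇒≤ (pos<n (e′ a)))

    Ascending : Fin n → Set
    Ascending z = (∀ a → z ≡ e a → Ascends a) × (∀ a → z ≡ e′ a → Ascends a)

    Slab : Fin m → Fin n → Set
    Slab c z = pos (e c) < pos z × pos z < pos (e′ c)

    -- From `e′ b = e a < e′ a` reflection of the order gives `e b < e a`, so ascent propagates
    -- backwards along a chain.
    ascends-pred : ∀ {a b} → e a ≡ e′ b → Ascends a → Ascends b
    ascends-pred {a} {b} eq up =
      subst (λ z → pos (e b) < pos z) eq (reflects b a (subst (λ z → pos z < pos (e′ a)) eq up))

    -- A step from a point of the slab starts beyond `e c`, hence lands beyond `e′ c`; a step into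
    -- the slab ends before `e′ c`, hence starts before `e c`.
    slab⇒ascending : ∀ {c z} → Slab c z → Ascending z
    slab⇒ascending {c} (lo , hi) =
      (λ { a refl → <-trans hi (preserves c a lo) }) , (λ { a refl → <-trans (reflects a c hi) lo })

    start-ascending : ∀ {s z} → Chain s z → Ascending z → Ascending s
    start-ascending [] up = up
    start-ascending {z = z} (step b refl ch) up =
      (λ a eq → subst₂ (λ x y → pos x < pos y) eq (e≡⇒e′≡ eq) b-up) , (λ a eq → ascends-pred eq b-up)
      where
      b-up : Ascends b
      b-up = proj₂ (start-ascending ch up) b refl

    -- Ascent at the end point propagates back to every step, and each ascending step adds exactly
    -- `2 ^ n` to the height.
    chain-climbs : ∀ {s z} → Chain s z → Ascending z →
      s ≡ z ⊎ (∃[ b ] (s ≡ e b × height s + 2 ^ n ≤ height z))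
    chain-rises : ∀ {s z} → Chain s z → Ascending z → height s ≤ height z

    chain-climbs [] up = inj₁ refl
    chain-climbs (step b refl ch) up = inj₂ (b , refl ,
      subst (_≤ _) (height-shift (proj₂ (start-ascending ch up) b refl)) (chain-rises ch up))

    chain-rises ch up with chain-climbs ch up
    ... | inj₁ refl = ≤-refl
    ... | inj₂ (_ , _ , le) = ≤-trans (m≤m+n _ (2 ^ n)) le

    -- One shift below `e′ c` is `e c`, so a chain that has climbed a shift and still ends before
    -- `e′ c` began lower than `e c`.
    start-below : ∀ {c s z} → Ascends c → height s + 2 ^ n ≤ height z → pos z < pos (e′ c) → height s < height (e c)
    start-below c-up climb z<c′ = +-cancelʳ-< (2 ^ n) _ _
      (≤-<-trans climb (<-≤-trans (height-mono z<c′) (≤-reflexive (height-shift c-up))))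

    chain-pos : ∀ {s z} → Chain s z → Ascending z → pos s ≤ pos z
    chain-pos ch up = ≮⇒≥ λ lt → <⇒≱ (height-mono lt) (chain-rises ch up)

    -- Predecessors in an ascending chain have smaller `pos`, so tracing back from `y` must stop,
    -- and it stops only outside the image of `e′`.
    chain-start : ∀ {y z} → Acc _<_ (pos y) → Chain y z → Ascending z → ∃[ s ] ((∀ a → e′ a ≢ s) × Chain s z)
    chain-start {y} (acc rs) ch up with any? (λ a → e′ a ≟ᶠ y)
    ... | no ∄a = y , (λ a eq → ∄a (a , eq)) , ch
    ... | yes (a , refl) = chain-start (rs (proj₂ (start-ascending ch up) a refl)) (step a refl ch) up

    -- The chain of `e c` jumps from one end of the slab to the other.
    slab-leaves-own-chain : ∀ {c z} → Slab c z → ¬ Chain (e c) z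
    slab-leaves-own-chain (lo , _) [] = <-irrefl refl lo
    slab-leaves-own-chain {c} {z} sl@(_ , hi) (step b eq ch) =
      <⇒≱ hi (≤-trans (≤-reflexive (cong pos (e≡⇒e′≡ eq))) (chain-pos ch (slab⇒ascending sl)))

    -- A step from inside the slab overshoots `e′ c`, and the chain does not come back.
    slab-chain-trivial : ∀ {c z z′} → Slab c z → Slab c z′ → Chain z z′ → z ≡ z′
    slab-chain-trivial _ _ [] = refl
    slab-chain-trivial {c} (lo , _) sl′@(_ , hi′) (step b refl ch) =
      contradiction (<-trans (preserves c b lo) (≤-<-trans (chain-pos ch (slab⇒ascending sl′)) hi′)) (<-irrefl refl)

    chain-compare : ∀ {s z z′} → Chain s z → Chain s z′ → Chain z z′ ⊎ Chain z′ z
    chain-compare [] ch′ = inj₁ ch′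
    chain-compare ch [] = inj₂ ch
    chain-compare (step b refl ch) (step b′ eq ch′) =
      chain-compare ch (subst (λ s → Chain s _) (sym (e≡⇒e′≡ eq)) ch′)

    slab-unique : ∀ {c s z z′} → Slab c z → Slab c z′ → Chain s z → Chain s z′ → z ≡ z′
    slab-unique sl sl′ ch ch′ with chain-compare ch ch′
    ... | inj₁ zz′ = slab-chain-trivial sl sl′ zz′
    ... | inj₂ z′z = sym (slab-chain-trivial sl′ sl z′z)

    Strip : ℕ → ℕ → Fin n → Set
    Strip lo hi z = lo < pos z × pos z < hi

    -- A chain meets a slab at most once, so the points of a strip have distinct chain starts.
    strip-starts : ∀ {c lo hi} → hi ≤ n → (∀ {z} → Strip lo hi z → Slab c z) →
      Σ (Fin (hi ∸ suc lo) → Fin n) λ g → Injective _≡_ _≡_ g ×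
        (∀ i → (∀ a → e′ a ≢ g i) × ∃[ z ] (Strip lo hi z × Chain (g i) z))
    strip-starts {c} {lo} {hi} hi≤n slab = (λ i → proj₁ (start i)) ,
      (λ {i} {j} eq → toℕ-injective (+-cancelˡ-≡ (suc lo) _ _
        (trans (sym (pos-point i)) (trans
          (cong pos (slab-unique (slab (in-strip i)) (slab (in-strip j)) (proj₂ (proj₂ (start i)))
            (subst (λ s → Chain s (point j)) (sym eq) (proj₂ (proj₂ (start j))))))
          (pos-point j))))) ,
      (λ i → proj₁ (proj₂ (start i)) , point i , in-strip i , proj₂ (proj₂ (start i)))
      where
      below : ∀ (i : Fin (hi ∸ suc lo)) → suc lo + toℕ i < hi
      below i = ≤-trans (≤-reflexive (sym (+-suc (suc lo) (toℕ i)))) (≤-trans (+-monoʳ-≤ (suc lo) (toℕ<n i)) (≤-reflexive (m+[n∸m]≡n 1+lo≤hi)))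
        where
        1+lo≤hi : suc lo ≤ hi
        1+lo≤hi = <⇒≤ (m∸n≢0⇒n<m λ eq → contradiction (subst (toℕ i <_) eq (toℕ<n i)) λ ())
      preimage : ∀ i → ∃[ x ] pos x ≡ suc lo + toℕ i
      preimage i = pos-surjective _ (<-≤-trans (below i) hi≤n)
      point : Fin (hi ∸ suc lo) → Fin n
      point i = proj₁ (preimage i)
      pos-point : ∀ i → pos (point i) ≡ suc lo + toℕ i
      pos-point i = proj₂ (preimage i)
      in-strip : ∀ i → Strip lo hi (point i)
      in-strip i rewrite pos-point i = s≤s (m≤m+n lo (toℕ i)) , below i
      start : ∀ i → ∃[ s ] ((∀ a → e′ a ≢ s) × Chain s (point i))
      start i = chain-start (<-wellFounded _) [] (slab⇒ascending (slab (in-strip i)))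

  -- Two strips and the distance bound

  module Plane (X Y : Coordinate e e′) (e-inj : ∀ {a b} → e a ≡ e b → a ≡ b) where
    module X = Line X
    module Y = Line Y

    -- Pigeonhole in `Fin n`: `x₀`, the chain starts of the two strips and the `m` points of `e′`
    -- are pairwise distinct. The last hypothesis keeps the two families of starts apart.
    strips-bound : ∀ {c d x₀ lo hi lo′ hi′} → hi ≤ n → hi′ ≤ n → (∀ a → e′ a ≢ x₀) →
      (∀ {z} → X.Strip lo hi z → X.Slab c z) → (∀ {z} → Y.Strip lo′ hi′ z → Y.Slab d z) →
      (∀ {z} → X.Strip lo hi z → ¬ Chain x₀ z) → (∀ {z} → Y.Strip lo′ hi′ z → ¬ Chain x₀ z) →
      (∀ {s z z′} → X.Strip lo hi z → Y.Strip lo′ hi′ z′ → Chain s z → Chain s z′ → ⊥) →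
      suc ((hi ∸ suc lo) + (hi′ ∸ suc lo′) + m) ≤ n
    strips-bound {x₀ = x₀} {lo} {hi} {lo′} {hi′} hi≤n hi′≤n x₀∉e′ slabX slabY ownX ownY noDouble
      with X.strip-starts hi≤n slabX | Y.strip-starts hi′≤n slabY
    ... | g , g-inj , gs | g′ , g′-inj , gs′ =
      injective⇒≤ {f = [ (λ (_ : Fin 1) → x₀) , _ ]′ ∘ splitAt 1}
        (disjoint-⊎ (λ (_ : Fin 1) → x₀) ([ [ g , g′ ]′ ∘ splitAt _ , e′ ]′ ∘ splitAt _)
          (λ { {Fin.zero} {Fin.zero} _ → refl })
          (disjoint-⊎ ([ g , g′ ]′ ∘ splitAt _) e′
            (disjoint-⊎ g g′ g-inj g′-inj clash) (e-inj ∘ X.e′≡⇒e≡)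
            (λ i a → avoids-e′ (splitAt _ i) a))
          (λ _ i → avoids-x₀ (splitAt _ i)))
      where
      clash : ∀ i j → g i ≢ g′ j
      clash i j eq with gs i | gs′ j
      ... | _ , z , st , ch | _ , z′ , st′ , ch′ = noDouble st st′ ch (subst (λ s → Chain s z′) (sym eq) ch′)
      avoids-e′ : ∀ t a → [ g , g′ ]′ t ≢ e′ a
      avoids-e′ (inj₁ i) a eq = proj₁ (gs i) a (sym eq)
      avoids-e′ (inj₂ i) a eq = proj₁ (gs′ i) a (sym eq)
      avoids-strips : ∀ t → x₀ ≢ [ g , g′ ]′ t
      avoids-strips (inj₁ i) eq with gs i
      ... | _ , z , st , ch = ownX st (subst (λ s → Chain s z) (sym eq) ch)
      avoids-strips (inj₂ i) eq with gs′ i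
      ... | _ , z , st , ch = ownY st (subst (λ s → Chain s z) (sym eq) ch)
      avoids-x₀ : ∀ t → x₀ ≢ [ [ g , g′ ]′ ∘ splitAt (hi ∸ suc lo) , e′ ]′ t
      avoids-x₀ (inj₁ i) = avoids-strips (splitAt _ i)
      avoids-x₀ (inj₂ a) eq = x₀∉e′ a (sym eq)

    -- Distance at least `(n - m) + 2`, stated without subtraction.
    Far : Set
    Far = ∀ {x y} → x ≢ y → n + 2 ≤ ∣ X.pos x - X.pos y ∣ + ∣ Y.pos x - Y.pos y ∣ + m

    -- Each coordinate difference exceeds the size of its strip by one, so `few` leaves a distance
    -- of at most `n - m + 1`.
    too-close : ∀ {lo hi lo′ hi′} → lo < hi → lo′ < hi′ →
      suc ((hi ∸ suc lo) + (hi′ ∸ suc lo′) + m) ≤ n → ¬ (n + 2 ≤ ∣ lo - hi ∣ + ∣ lo′ - hi′ ∣ + m)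
    too-close {lo} {hi} {lo′} {hi′} lt lt′ few far = 1+n≰n (begin
      2 + n                           ≡⟨ +-comm 2 n ⟩
      n + 2                           ≤⟨ far ⟩
      ∣ lo - hi ∣ + ∣ lo′ - hi′ ∣ + m ≡⟨ cong₂ (λ a b → a + b + m) (gap lt) (gap lt′) ⟩
      suc A + suc B + m               ≡⟨ cong (λ a → suc a + m) (+-suc A B) ⟩
      suc (suc (A + B + m))           ≤⟨ s≤s few ⟩
      suc n                           ∎)
      where
      open ≤-Reasoning
      A = hi ∸ suc lo
      B = hi′ ∸ suc lo′
      gap : ∀ {lo hi} → lo < hi → ∣ lo - hi ∣ ≡ suc (hi ∸ suc lo)
      gap lt = trans (m≤n⇒∣m-n∣≡n∸m (<⇒≤ lt)) (+-∸-assoc 1 lt)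

    Minimal : Fin m → Set
    Minimal c = ∀ {b} → X.Ascends b → Y.Ascends b →
      X.height (e c) + Y.height (e c) ≤ X.height (e b) + Y.height (e b)

    -- Otherwise `e b` would be at least a full shift below `e c` in X and less than a shift above
    -- it in Y, undercutting the total height of `c`. Supplies the last hypothesis of
    -- `antidiagonal`.
    minimal-overtaken : ∀ {b c} → Minimal c → X.Ascends b → Y.Ascends b → Y.Ascends c →
      Y.pos (e b) < Y.pos (e′ c) → X.pos (e c) < X.pos (e′ b)
    minimal-overtaken {b} {c} c-min b-up b-up′ c-up′ b<c′ =
      X.height-reflects (subst (X.height (e c) <_) (sym (X.height-shift b-up))
        (+-cancelʳ-< (Y.height (e c)) _ _ (begin-strict
          X.height (e c) + Y.height (e c)           ≤⟨ c-min b-up b-up′ ⟩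
          X.height (e b) + Y.height (e b)           <⟨ +-monoʳ-< (X.height (e b)) (Y.height-mono b<c′) ⟩
          X.height (e b) + Y.height (e′ c)          ≡⟨ cong (X.height (e b) +_) (Y.height-shift c-up′) ⟩
          X.height (e b) + (Y.height (e c) + 2 ^ n) ≡⟨ x∙yz≈xz∙y (X.height (e b)) _ _ ⟩
          X.height (e b) + 2 ^ n + Y.height (e c)   ∎)))
      where open ≤-Reasoning

    -- The induction on y disposes of points inside the rectangle.  Any other
    -- chain meeting both strips would start at an index of smaller total height than c.
    antidiagonal : ∀ {c d y} → Acc _<_ (X.pos y) → Far → (∀ a → e′ a ≢ e c) → Minimal c →
      X.Ascends c → X.pos (e c) < X.pos y → X.pos y ≤ X.pos (e′ c) →
      Y.pos (e d) ≤ Y.pos y → Y.pos y < Y.pos (e c) → Y.pos (e c) ≤ Y.pos (e′ d) → ⊥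
    antidiagonal {c} {d} {y} (acc rs) far c-start c-min c-up c<y y≤c′ d≤y y<c c≤d′ =
      too-close c<y y<c
        (strips-bound {c} {d} (<⇒≤ (X.pos<n y)) (<⇒≤ (Y.pos<n (e c))) c-start slabX slabY
          (X.slab-leaves-own-chain ∘ slabX) ownY noDouble)
        (subst (λ b → n + 2 ≤ ∣ X.pos (e c) - X.pos y ∣ + b + m) (∣-∣-comm (Y.pos (e c)) (Y.pos y))
          (far λ eq → <-irrefl (cong X.pos eq) c<y))
      where
      InX = X.Strip (X.pos (e c)) (X.pos y)
      InY = Y.Strip (Y.pos y) (Y.pos (e c))
      slabX : ∀ {z} → InX z → X.Slab c z
      slabX (lo , hi) = lo , <-≤-trans hi y≤c′
      slabY : ∀ {z} → InY z → Y.Slab d z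
      slabY (lo , hi) = ≤-<-trans d≤y lo , <-≤-trans hi c≤d′
      ownY : ∀ {z} → InY z → ¬ Chain (e c) z
      ownY st@(_ , hi) ch = <⇒≱ hi (Y.chain-pos ch (Y.slab⇒ascending (slabY st)))
      noDouble : ∀ {s z z′} → InX z → InY z′ → Chain s z → Chain s z′ → ⊥
      noDouble {s} {z} {z′} st st′ ch ch′
        with X.slab⇒ascending (slabX st) | Y.slab⇒ascending (slabY st′)
      ... | up | up′ with X.chain-climbs ch up | Y.chain-climbs ch′ up′
      ... | inj₁ refl | inj₁ refl =
            antidiagonal (rs (proj₂ st)) far c-start c-min c-up (proj₁ st) (<⇒≤ (proj₂ (slabX st)))
              (<⇒≤ (proj₁ (slabY st′))) (proj₂ st′) c≤d′
      ... | inj₂ (b , refl , climb) | _ = <⇒≱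
            (+-mono-< (X.start-below c-up climb (proj₂ (slabX st)))
                      (≤-<-trans (Y.chain-rises ch′ up′) (Y.height-mono (proj₂ st′))))
            (c-min (proj₁ (X.start-ascending ch up) b refl) (proj₁ (Y.start-ascending ch′ up′) b refl))
      -- In X the start `s` is less than one shift above `e c`, in Y more than one shift below it.
      ... | inj₁ refl | inj₂ (b , refl , climb) = <⇒≱
            (+-cancelʳ-< (2 ^ n) _ _ (begin-strict
              X.height s + Y.height s + 2 ^ n          ≡⟨ +-assoc (X.height s) _ _ ⟩
              X.height s + (Y.height s + 2 ^ n)        <⟨ +-mono-<-≤ (X.height-mono (proj₂ (slabX st)))
                                                            (≤-trans climb (<⇒≤ (Y.height-mono (proj₂ st′)))) ⟩
              X.height (e′ c) + Y.height (e c)         ≡⟨ cong (_+ Y.height (e c)) (X.height-shift c-up) ⟩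
              X.height (e c) + 2 ^ n + Y.height (e c)  ≡⟨ xy∙z≈xz∙y (X.height (e c)) (2 ^ n) (Y.height (e c)) ⟩
              X.height (e c) + Y.height (e c) + 2 ^ n  ∎))
            (c-min (proj₁ (X.start-ascending ch up) b refl) (proj₁ (Y.start-ascending ch′ up′) b refl))
        where open ≤-Reasoning

  module _ (X Y : Coordinate e e′) (e-inj : ∀ {a b} → e a ≡ e b → a ≡ b) where
    open Plane X Y e-inj
    private
      module Transposed = Plane Y X e-inj

    far-transposed : Far → Transposed.Far
    far-transposed far {x} {y} x≢y =
      subst (λ d → n + 2 ≤ d + m) (+-comm ∣ X.pos x - X.pos y ∣ ∣ Y.pos x - Y.pos y ∣) (far x≢y)

    minimal-transposed : ∀ {c} → Minimal c → Transposed.Minimal c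
    minimal-transposed {c} c-min {b} up up′ =
      subst₂ _≤_ (+-comm (X.height (e c)) _) (+-comm (X.height (e b)) _) (c-min up′ up)

    -- Here a chain meeting both strips may exist, but by minimality of c its
    -- start is then in antidiagonal position with respect to e c.
    diagonal : ∀ {c y} → Acc _<_ (X.pos y) → Far → (∀ a → e′ a ≢ e c) → Minimal c →
      X.Ascends c → Y.Ascends c → X.pos (e c) < X.pos y → X.pos y ≤ X.pos (e′ c) →
      Y.pos (e c) < Y.pos y → Y.pos y ≤ Y.pos (e′ c) → ⊥
    diagonal {c} {y} (acc rs) far c-start c-min c-up c-up′ c<y y≤c′ c<y′ y≤c′′ =
      too-close c<y c<y′
        (strips-bound {c} {c} (<⇒≤ (X.pos<n y)) (<⇒≤ (Y.pos<n y)) c-start slabX slabY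
          (X.slab-leaves-own-chain ∘ slabX) (Y.slab-leaves-own-chain ∘ slabY) noDouble)
        (far λ eq → <-irrefl (cong X.pos eq) c<y)
      where
      InX = X.Strip (X.pos (e c)) (X.pos y)
      InY = Y.Strip (Y.pos (e c)) (Y.pos y)
      slabX : ∀ {z} → InX z → X.Slab c z
      slabX (lo , hi) = lo , <-≤-trans hi y≤c′
      slabY : ∀ {z} → InY z → Y.Slab c z
      slabY (lo , hi) = lo , <-≤-trans hi y≤c′′
      noDouble : ∀ {s z z′} → InX z → InY z′ → Chain s z → Chain s z′ → ⊥
      noDouble {s} {z} {z′} st st′ ch ch′
        with X.slab⇒ascending (slabX st) | Y.slab⇒ascending (slabY st′)
      ... | up | up′ with X.chain-climbs ch up | Y.chain-climbs ch′ up′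
      ... | inj₁ refl | inj₁ refl =
            diagonal (rs (proj₂ st)) far c-start c-min c-up c-up′
              (proj₁ st) (<⇒≤ (proj₂ (slabX st))) (proj₁ st′) (<⇒≤ (proj₂ (slabY st′)))
      ... | inj₂ (b , refl , climb) | inj₂ (_ , _ , climb′) = <⇒≱
            (+-mono-< (X.start-below c-up climb (proj₂ (slabX st))) (Y.start-below c-up′ climb′ (proj₂ (slabY st′))))
            (c-min (proj₁ (X.start-ascending ch up) b refl) (proj₁ (Y.start-ascending ch′ up′) b refl))
      -- The start `e b` lies to the upper left of `e c`, and the step of `b` spans the horizontal
      -- gap between them, so `d` is `b`.
      ... | inj₂ (b , refl , climb) | inj₁ refl =
            Transposed.antidiagonal (<-wellFounded _) (far-transposed far) c-start (minimal-transposed c-min)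
              c-up′ (proj₁ st′) (<⇒≤ (proj₂ (slabY st′)))
              ≤-refl (X.height-reflects (X.start-below c-up climb (proj₂ (slabX st))))
              (<⇒≤ (minimal-overtaken c-min (proj₁ (X.start-ascending ch up) b refl)
                (proj₁ (Y.start-ascending ch′ up′) b refl) c-up′ (proj₂ (slabY st′))))
      -- The mirror case: `e b` lies to the lower right of `e c`.
      ... | inj₁ refl | inj₂ (b , refl , climb′) =
            antidiagonal (<-wellFounded _) far c-start c-min
              c-up (proj₁ st) (<⇒≤ (proj₂ (slabX st)))
              ≤-refl (Y.height-reflects (Y.start-below c-up′ climb′ (proj₂ (slabY st′))))
              (<⇒≤ (Transposed.minimal-overtaken (minimal-transposed c-min) (proj₁ (Y.start-ascending ch′ up′) b refl)
                (proj₁ (X.start-ascending ch up) b refl) c-up (proj₂ (slabX st))))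

    -- Well-founded induction on total height supplies minimality: all lower steps are excluded
    -- already, and a predecessor of `e c` would give such a step. Then `diagonal` applies with
    -- `y = e′ c`.
    far⇒no-ascent : Far → ∀ c → Acc _<_ (X.height (e c) + Y.height (e c)) → X.Ascends c → Y.Ascends c → ⊥
    far⇒no-ascent far c (acc rs) c-up c-up′ =
      diagonal (<-wellFounded _) far c-start c-min c-up c-up′ c-up ≤-refl c-up′ ≤-refl
      where
      c-min : Minimal c
      c-min {b} b-up b-up′ = ≮⇒≥ λ lt → far⇒no-ascent far b (rs lt) b-up b-up′
      c-start : ∀ a → e′ a ≢ e c
      c-start a eq = <⇒≱
        (subst (λ z → X.height (e a) + Y.height (e a) < X.height z + Y.height z) eq
          (+-mono-< (X.height-mono a-up) (Y.height-mono a-up′)))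
        (c-min a-up a-up′)
        where
        a-up : X.Ascends a
        a-up = X.ascends-pred (sym eq) c-up
        a-up′ : Y.Ascends a
        a-up′ = Y.ascends-pred (sym eq) c-up′

-- Symmetries: reversed axes and exchanged embeddings

∣-∣-reverse : ∀ {n a b} → a < n → b < n → ∣ n ∸ suc a - n ∸ suc b ∣ ≡ ∣ a - b ∣
∣-∣-reverse {n} {a} {b} a<n b<n = begin
  ∣ n ∸ suc a - n ∸ suc b ∣                                 ≡⟨ ∣m+n-m+o∣≡∣n-o∣ (suc a + suc b) _ _ ⟨
  ∣ suc a + suc b + (n ∸ suc a) - suc a + suc b + (n ∸ suc b) ∣
    ≡⟨ cong₂ ∣_-_∣ (trans (cong (_+ (n ∸ suc a)) (+-comm (suc a) (suc b))) (trans (+-assoc (suc b) (suc a) _) (trans (cong (suc b +_) (m+[n∸m]≡n a<n)) (+-comm (suc b) n))))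
                   (trans (+-assoc (suc a) (suc b) _) (trans (cong (suc a +_) (m+[n∸m]≡n b<n)) (+-comm (suc a) n))) ⟩
  ∣ n + suc b - n + suc a ∣                                 ≡⟨ ∣m+n-m+o∣≡∣n-o∣ n (suc b) (suc a) ⟩
  ∣ b - a ∣                                                 ≡⟨ ∣-∣-comm b a ⟩
  ∣ a - b ∣                                                 ∎
  where open ≡-Reasoning

module _ {n m : ℕ} {e e′ : Fin m → Fin n} where

  reverse : Coordinate e e′ → Coordinate e e′
  reverse X = record
    { pos = λ x → n ∸ suc (pos x)
    ; pos-injective = λ {x} {y} eq → pos-injective (cong pred (∸-cancelˡ-≡ (pos<n x) (pos<n y) eq))
    ; pos<n = λ x → ∸-monoʳ-< (s≤s z≤n) (pos<n x)
    ; pos-surjective = λ i i<n → let x , eq = pos-surjective (n ∸ suc i) (∸-monoʳ-< (s≤s z≤n) i<n) in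
        x , trans (cong (λ j → n ∸ suc j) eq) (trans (cong (n ∸_) (sym (+-∸-assoc 1 i<n))) (m∸[m∸n]≡n (<⇒≤ i<n)))
    ; preserves = λ a b lt → ∸-monoʳ-< (s≤s (preserves b a (s≤s⁻¹ (∸-cancelʳ-< {suc (pos (e a))} {suc (pos (e b))} {n} lt)))) (pos<n (e′ a))
    ; reflects = λ a b lt → ∸-monoʳ-< (s≤s (reflects b a (s≤s⁻¹ (∸-cancelʳ-< {suc (pos (e′ a))} {suc (pos (e′ b))} {n} lt)))) (pos<n (e a))
    }
    where open Coordinate X

  swap : Coordinate e e′ → Coordinate e′ e
  swap X = record
    { pos = pos ; pos-injective = pos-injective ; pos<n = pos<n ; pos-surjective = pos-surjective
    ; preserves = reflects ; reflects = preserves }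
    where open Coordinate X

module _ {n m : ℕ} {e e′ : Fin m → Fin n} (X Y : Coordinate e e′) (e-inj : ∀ {a b} → e a ≡ e b → a ≡ b) where
  open Plane X Y e-inj

  far-reverse : Far → Plane.Far X (reverse Y) e-inj
  far-reverse far {x} {y} x≢y =
    subst (λ d → n + 2 ≤ ∣ X.pos x - X.pos y ∣ + d + m) (sym (∣-∣-reverse (Y.pos<n x) (Y.pos<n y))) (far x≢y)

  far⇒no-rightward-move : Far → ∀ c → ¬ X.Ascends c
  far⇒no-rightward-move far c c-right with <-cmp (Y.pos (e c)) (Y.pos (e′ c))
  ... | tri< up _ _ = far⇒no-ascent X Y e-inj far c (<-wellFounded _) c-right up
  ... | tri≈ _ eq _ = <-irrefl (cong X.pos (Y.pos-injective eq)) c-right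
  -- Reversing the vertical axis turns a downward step into an upward one.
  ... | tri> _ _ down = far⇒no-ascent X (reverse Y) e-inj (far-reverse far) c (<-wellFounded _) c-right
                          (∸-monoʳ-< (s≤s down) (Y.pos<n (e c)))

far⇒embedding-unique : ∀ {n m} {e e′ : Fin m → Fin n} (X Y : Coordinate e e′) (e-inj : ∀ {a b} → e a ≡ e b → a ≡ b) →
  Plane.Far X Y e-inj → ∀ c → e c ≡ e′ c
far⇒embedding-unique {e = e} {e′} X Y e-inj far c with <-cmp (X.pos (e c)) (X.pos (e′ c))
  where module X = Coordinate X
... | tri< lt _ _ = contradiction lt (far⇒no-rightward-move X Y e-inj far c)
... | tri≈ _ eq _ = Coordinate.pos-injective X eq
-- Exchanging `e` and `e′` turns a leftward move into a rightward one.
... | tri> _ _ gt = contradiction gt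
  (far⇒no-rightward-move (swap X) (swap Y) (e-inj ∘ Line.e′≡⇒e≡ X) far c)

-- Counting, thinnings and standardisation

count : ∀ {n} {Q : Fin n → Set} → (∀ i → Dec (Q i)) → ℕ
count {zero} Q? = 0
count {suc n} Q? with Q? zero
... | yes _ = suc (count (Q? ∘ suc))
... | no _ = count (Q? ∘ suc)

count-mono : ∀ {n} {Q R : Fin n → Set} (Q? : ∀ i → Dec (Q i)) (R? : ∀ i → Dec (R i)) →
  (∀ i → Q i → R i) → count Q? ≤ count R?
count-mono {zero} Q? R? Q⊆R = z≤n
count-mono {suc n} Q? R? Q⊆R with Q? zero | R? zero
... | yes q | yes r = s≤s (count-mono (Q? ∘ suc) (R? ∘ suc) (Q⊆R ∘ suc))
... | yes q | no ¬r = contradiction (Q⊆R zero q) ¬r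
... | no ¬q | yes r = m≤n⇒m≤1+n (count-mono (Q? ∘ suc) (R? ∘ suc) (Q⊆R ∘ suc))
... | no ¬q | no ¬r = count-mono (Q? ∘ suc) (R? ∘ suc) (Q⊆R ∘ suc)

count-mono-< : ∀ {n} {Q R : Fin n → Set} (Q? : ∀ i → Dec (Q i)) (R? : ∀ i → Dec (R i)) →
  (∀ i → Q i → R i) → ∀ i → ¬ Q i → R i → count Q? < count R?
count-mono-< {suc n} Q? R? Q⊆R i ¬qi ri with Q? zero | R? zero
count-mono-< {suc n} Q? R? Q⊆R zero ¬qi ri | yes q | _ = contradiction q ¬qi
count-mono-< {suc n} Q? R? Q⊆R zero ¬qi ri | no ¬q | yes r = s≤s (count-mono (Q? ∘ suc) (R? ∘ suc) (Q⊆R ∘ suc))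
count-mono-< {suc n} Q? R? Q⊆R zero ¬qi ri | no ¬q | no ¬r = contradiction ri ¬r
count-mono-< {suc n} Q? R? Q⊆R (suc i) ¬qi ri | yes q | yes r = s≤s (count-mono-< (Q? ∘ suc) (R? ∘ suc) (Q⊆R ∘ suc) i ¬qi ri)
count-mono-< {suc n} Q? R? Q⊆R (suc i) ¬qi ri | yes q | no ¬r = contradiction (Q⊆R zero q) ¬r
count-mono-< {suc n} Q? R? Q⊆R (suc i) ¬qi ri | no ¬q | yes r = m<n⇒m<1+n (count-mono-< (Q? ∘ suc) (R? ∘ suc) (Q⊆R ∘ suc) i ¬qi ri)
count-mono-< {suc n} Q? R? Q⊆R (suc i) ¬qi ri | no ¬q | no ¬r = count-mono-< (Q? ∘ suc) (R? ∘ suc) (Q⊆R ∘ suc) i ¬qi ri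

everything : ∀ {n} (i : Fin n) → Dec ⊤
everything _ = yes tt

count-everything : ∀ n → count (everything {n}) ≡ n
count-everything zero = refl
count-everything (suc n) = cong suc (count-everything n)

count-subadditive : ∀ {n} {S Q R : Fin n → Set} (S? : ∀ i → Dec (S i)) (Q? : ∀ i → Dec (Q i)) (R? : ∀ i → Dec (R i)) →
  (∀ i → S i → Q i ⊎ R i) → count S? ≤ count Q? + count R?
count-subadditive {zero} S? Q? R? cover = z≤n
count-subadditive {suc n} S? Q? R? cover
  with S? zero | Q? zero | R? zero | count-subadditive (S? ∘ suc) (Q? ∘ suc) (R? ∘ suc) (cover ∘ suc)
... | yes s | no ¬q | no ¬r | ih = [ (λ q → contradiction q ¬q) , (λ r → contradiction r ¬r) ]′ (cover zero s)
... | yes s | yes _ | yes _ | ih = s≤s (≤-trans ih (+-monoʳ-≤ _ (n≤1+n _)))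
... | yes s | yes _ | no _ | ih = s≤s ih
... | yes s | no _ | yes _ | ih = ≤-trans (s≤s ih) (≤-reflexive (sym (+-suc _ _)))
... | no _ | yes _ | yes _ | ih = m≤n⇒m≤1+n (≤-trans ih (+-monoʳ-≤ _ (n≤1+n _)))
... | no _ | yes _ | no _ | ih = m≤n⇒m≤1+n ih
... | no _ | no _ | yes _ | ih = ≤-trans ih (+-monoʳ-≤ _ (n≤1+n _))
... | no _ | no _ | no _ | ih = ih

-- The `m`-element subsets of `Fin n` as bit strings, `keep` marking the members; unlike functions,
-- they can be compared by `≡` and listed.
data Thinning : ℕ → ℕ → Set where
  done : Thinning 0 0
  keep : ∀ {m n} → Thinning m n → Thinning (suc m) (suc n)
  skip : ∀ {m n} → Thinning m n → Thinning m (suc n)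

⟦_⟧ : ∀ {m n} → Thinning m n → Fin m → Fin n
⟦ keep t ⟧ zero = zero
⟦ keep t ⟧ (suc a) = suc (⟦ t ⟧ a)
⟦ skip t ⟧ a = suc (⟦ t ⟧ a)

⟦⟧-increasing : ∀ {m n} (t : Thinning m n) {a b} → a <ᶠ b → ⟦ t ⟧ a <ᶠ ⟦ t ⟧ b
⟦⟧-increasing (keep t) {zero} {suc b} _ = s≤s z≤n
⟦⟧-increasing (keep t) {suc a} {suc b} (s≤s lt) = s≤s (⟦⟧-increasing t lt)
⟦⟧-increasing (skip t) lt = s≤s (⟦⟧-increasing t lt)

increasing⇒injective : ∀ {m n} (f : Fin m → Fin n) → (∀ {a b} → a <ᶠ b → f a <ᶠ f b) → ∀ {a b} → f a ≡ f b → a ≡ b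
increasing⇒injective f f-inc {a} {b} eq with <ᶠ-cmp a b
... | tri< lt _ _ = contradiction (cong toℕ eq) (<⇒≢ (f-inc lt))
... | tri≈ _ a≡b _ = a≡b
... | tri> _ _ gt = contradiction (cong toℕ (sym eq)) (<⇒≢ (f-inc gt))

⟦⟧-injective : ∀ {m n} (t : Thinning m n) {a b} → ⟦ t ⟧ a ≡ ⟦ t ⟧ b → a ≡ b
⟦⟧-injective t = increasing⇒injective ⟦ t ⟧ (⟦⟧-increasing t)

⟦⟧-faithful : ∀ {m n} (t t′ : Thinning m n) → (∀ a → ⟦ t ⟧ a ≡ ⟦ t′ ⟧ a) → t ≡ t′
⟦⟧-faithful done done eq = refl
⟦⟧-faithful (keep t) (keep t′) eq = cong keep (⟦⟧-faithful t t′ (λ a → suc-injective (eq (suc a))))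
⟦⟧-faithful (keep t) (skip t′) eq = contradiction (eq zero) 0≢1+n
⟦⟧-faithful (skip t) (keep t′) eq = contradiction (sym (eq zero)) 0≢1+n
⟦⟧-faithful (skip t) (skip t′) eq = cong skip (⟦⟧-faithful t t′ (λ a → suc-injective (eq a)))

none : ∀ n → Thinning 0 n
none zero = done
none (suc n) = skip (none n)

positive⇒suc : ∀ {m n} (f : Fin m → Fin (suc n)) → (∀ a → zero ≢ f a) → Σ (Fin m → Fin n) λ g → ∀ a → f a ≡ suc (g a)
positive⇒suc f f≢0 = (λ a → proj₁ (go (f a) (f≢0 a))) , (λ a → proj₂ (go (f a) (f≢0 a)))
  where
  go : ∀ {n} (x : Fin (suc n)) → zero ≢ x → ∃[ y ] x ≡ suc y
  go zero 0≢0 = contradiction refl 0≢0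
  go (suc y) _ = y , refl

-- With `⟦⟧-faithful`, this identifies thinnings with strictly increasing maps, hence with the
-- choices of positions in `_≼_`.
⟦⟧-full : ∀ {m n} (f : Fin m → Fin n) → (∀ {a b} → a <ᶠ b → f a <ᶠ f b) → ∃[ t ] (∀ a → ⟦ t ⟧ a ≡ f a)
⟦⟧-full {zero} {n} f f-inc = none n , λ ()
⟦⟧-full {suc m} {zero} f f-inc = contradiction (f zero) λ ()
⟦⟧-full {suc m} {suc n} f f-inc with zero ≟ᶠ f zero
... | yes 0≡f0 with positive⇒suc (f ∘ suc) (λ a eq → <⇒≢ (f-inc {zero} {suc a} (s≤s z≤n)) (cong toℕ (trans (sym 0≡f0) eq)))
...   | g , f≡g with ⟦⟧-full g (λ {a} {b} lt → s≤s⁻¹ (subst₂ _<ᶠ_ (f≡g a) (f≡g b) (f-inc (s≤s lt))))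
...     | t , eq = keep t , λ { zero → 0≡f0 ; (suc a) → trans (cong suc (eq a)) (sym (f≡g a)) }
⟦⟧-full {suc m} {suc n} f f-inc | no 0≢f0 with positive⇒suc f positive
  where
  positive : ∀ a → zero ≢ f a
  positive zero = 0≢f0
  positive (suc a) eq = contradiction (subst (f zero <ᶠ_) (sym eq) (f-inc {zero} {suc a} (s≤s z≤n))) λ ()
... | g , f≡g with ⟦⟧-full g (λ {a} {b} lt → s≤s⁻¹ (subst₂ _<ᶠ_ (f≡g a) (f≡g b) (f-inc lt)))
...   | t , eq = skip t , λ a → trans (cong suc (eq a)) (sym (f≡g a))

thinnings : ∀ m n → List (Thinning m n)
thinnings zero zero = done ∷ []
thinnings zero (suc n) = map skip (thinnings zero n)
thinnings (suc m) zero = []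
thinnings (suc m) (suc n) = map keep (thinnings m n) ++ map skip (thinnings (suc m) n)

-- Pascal's rule: the first position is either kept or skipped.
length-thinnings : ∀ m n → length (thinnings m n) ≡ n C m
length-thinnings zero zero = refl
length-thinnings zero (suc n) = trans (length-map skip (thinnings zero n)) (length-thinnings zero n)
length-thinnings (suc m) zero = refl
length-thinnings (suc m) (suc n) = begin
  length (map keep (thinnings m n) ++ map skip (thinnings (suc m) n)) ≡⟨ length-++ (map keep (thinnings m n)) ⟩
  length (map keep (thinnings m n)) + length (map skip (thinnings (suc m) n))
    ≡⟨ cong₂ _+_ (trans (length-map keep (thinnings m n)) (length-thinnings m n))
                 (trans (length-map skip (thinnings (suc m) n)) (length-thinnings (suc m) n)) ⟩
  n C m + n C suc m ≡⟨ nCk+nC[k+1]≡[n+1]C[k+1] n m ⟩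
  suc n C suc m ∎
  where open ≡-Reasoning

∈-thinnings : ∀ {m n} (t : Thinning m n) → t ∈ thinnings m n
∈-thinnings done = here refl
∈-thinnings (keep t) = ∈-++⁺ˡ (∈-map⁺ keep (∈-thinnings t))
∈-thinnings {zero} (skip t) = ∈-map⁺ skip (∈-thinnings t)
∈-thinnings {suc m} {suc n} (skip t) = ∈-++⁺ʳ (map keep (thinnings m n)) (∈-map⁺ skip (∈-thinnings t))

thinnings-unique : ∀ m n → Unique (thinnings m n)
thinnings-unique zero zero = [] ∷ []
thinnings-unique zero (suc n) = Unique.map⁺ (λ { refl → refl }) (thinnings-unique zero n)
thinnings-unique (suc m) zero = []
thinnings-unique (suc m) (suc n) = Unique.++⁺
  (Unique.map⁺ (λ { refl → refl }) (thinnings-unique m n))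
  (Unique.map⁺ (λ { refl → refl }) (thinnings-unique (suc m) n))
  (λ { (k , s) → case (∈-map⁻ keep k) (∈-map⁻ skip s) })
  where
  case : ∀ {t} → (∃[ r ] (r ∈ thinnings m n × t ≡ keep r)) → ¬ (∃[ r ] (r ∈ thinnings (suc m) n × t ≡ skip r))
  case (_ , _ , refl) (_ , _ , ())

select : ∀ {n} {Q : Fin n → Set} (Q? : ∀ i → Dec (Q i)) m → m ≤ count Q? → Σ (Thinning m n) λ t → ∀ a → Q (⟦ t ⟧ a)
select {n} Q? zero _ = none n , λ ()
select {suc n} Q? (suc m) le with Q? zero
select {suc n} Q? (suc m) (s≤s le) | yes q with select (Q? ∘ suc) m le
... | t , Qt = keep t , λ { zero → q ; (suc a) → Qt a }
select {suc n} Q? (suc m) le | no _ with select (Q? ∘ suc) (suc m) le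
... | t , Qt = skip t , Qt

-- Greedy choice from the left, with one slot reserved for the prescribed `i`.
select-through : ∀ {n} {Q : Fin n → Set} (Q? : ∀ i → Dec (Q i)) m → suc m ≤ count Q? → ∀ i → Q i →
  Σ (Thinning (suc m) n) λ t → (∀ a → Q (⟦ t ⟧ a)) × ∃[ r ] ⟦ t ⟧ r ≡ i
select-through {suc n} Q? m le zero qi with Q? zero
... | no ¬q = contradiction qi ¬q
... | yes q with select (Q? ∘ suc) m (s≤s⁻¹ le)
...   | t , Qt = keep t , (λ { zero → q ; (suc a) → Qt a }) , zero , refl
-- The only slot is saved for `suc i`, even if `Q` holds at `zero`.
select-through {suc n} {Q} Q? zero le (suc i) qi =
  singleton (suc i) , (λ { zero → subst Q (sym (singleton-zero (suc i))) qi }) , zero , singleton-zero (suc i)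
  where
  singleton : ∀ {n} → Fin n → Thinning 1 n
  singleton zero = keep (none _)
  singleton (suc i) = skip (singleton i)
  singleton-zero : ∀ {n} (i : Fin n) → ⟦ singleton i ⟧ zero ≡ i
  singleton-zero zero = refl
  singleton-zero (suc i) = cong suc (singleton-zero i)
select-through {suc n} Q? (suc m) le (suc i) qi with Q? zero
... | yes q with select-through (Q? ∘ suc) m (s≤s⁻¹ le) i qi
...   | t , Qt , r , tr≡i = keep t , (λ { zero → q ; (suc a) → Qt a }) , suc r , cong suc tr≡i
select-through {suc n} Q? (suc m) le (suc i) qi | no _ with select-through (Q? ∘ suc) (suc m) le i qi
... | t , Qt , r , tr≡i = skip t , Qt , r , cong suc tr≡i

-- The elements counted, enumerated by `select`, inject into `Fin b` through the offset of `h` from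
-- `lo`.
count-interval : ∀ {n} {Q : Fin n → Set} (Q? : ∀ i → Dec (Q i)) (h : Fin n → ℕ) → (∀ {i j} → h i ≡ h j → i ≡ j) →
  ∀ lo b → (∀ i → Q i → lo ≤ h i × h i < lo + b) → count Q? ≤ b
count-interval Q? h h-inj lo b within with select Q? (count Q?) ≤-refl
... | t , Qt = injective⇒≤ {f = λ a → fromℕ< (offset<b a)} λ {a} {a′} eq →
      ⟦⟧-injective t (h-inj (∸-cancelʳ-≡ (proj₁ (within _ (Qt a))) (proj₁ (within _ (Qt a′))) (fromℕ<-injective _ _ (offset<b a) (offset<b a′) eq)))
  where
  offset<b : ∀ a → h (⟦ t ⟧ a) ∸ lo < b
  offset<b a = +-cancelˡ-< lo _ _ (subst (_< lo + b) (sym (m+[n∸m]≡n (proj₁ (within _ (Qt a))))) (proj₂ (within _ (Qt a))))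

injective⇒surjective : ∀ {n} (f : Fin n → Fin n) → (∀ {x y} → f x ≡ f y → x ≡ y) → ∀ y → ∃[ x ] f x ≡ y
injective⇒surjective f f-inj y with any? (λ x → f x ≟ᶠ y)
... | yes found = found
... | no ∄x = contradiction
  (injective⇒≤ (disjoint-⊎ (λ (_ : Fin 1) → y) f (λ { {zero} {zero} _ → refl }) f-inj (λ _ x eq → ∄x (x , sym eq))))
  1+n≰n

-- Induction on `v`: the entry of `π` one lower has value at least `v` under `π′`, and order
-- preservation adds one. Used in both directions to get equality.
order-determines-≤ : ∀ {m} (π π′ : Fin m → Fin m) → (∀ {x y} → π x ≡ π y → x ≡ y) →
  (∀ a b → π a <ᶠ π b → π′ a <ᶠ π′ b) → ∀ v a → toℕ (π a) ≡ v → v ≤ toℕ (π′ a)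
order-determines-≤ π π′ π-inj mono zero a _ = z≤n
order-determines-≤ {m} π π′ π-inj mono (suc v) a πa≡1+v with injective⇒surjective π π-inj (fromℕ< v<m)
  where
  v<m : v < m
  v<m = <⇒≤ (subst (_< m) πa≡1+v (toℕ<n (π a)))
... | b , πb≡v = ≤-<-trans (order-determines-≤ π π′ π-inj mono v b toℕπb≡v)
                   (mono b a (≤-reflexive (trans (cong suc toℕπb≡v) (sym πa≡1+v))))
  where
  toℕπb≡v : toℕ (π b) ≡ v
  toℕπb≡v = trans (cong toℕ πb≡v) (toℕ-fromℕ< _)

order-determines : ∀ {m} (π π′ : Vec (Fin m) m) → IsPerm π → IsPerm π′ →
  (∀ a b → lookup π a <ᶠ lookup π b ⇔ lookup π′ a <ᶠ lookup π′ b) → π ≡ π′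
order-determines π π′ perm perm′ same = begin
  π                     ≡⟨ tabulate∘lookup π ⟨
  tabulate (lookup π)   ≡⟨ tabulate-cong (λ a → toℕ-injective (≤-antisym
                             (order-determines-≤ (lookup π) (lookup π′) (perm _ _) (λ a b → to (same a b)) _ a refl)
                             (order-determines-≤ (lookup π′) (lookup π) (perm′ _ _) (λ a b → from (same a b)) _ a refl))) ⟩
  tabulate (lookup π′)  ≡⟨ tabulate∘lookup π′ ⟩
  π′                    ∎
  where open ≡-Reasoning

-- Standardisation by ranks

module _ {m : ℕ} (h : Fin m → ℕ) where

  below? : ∀ a b → Dec (h b < h a)
  below? a b = h b <? h a

  rank<m : ∀ a → count (below? a) < m
  rank<m a = subst (count (below? a) <_) (count-everything m)
    (count-mono-< (below? a) everything (λ _ _ → tt) a (<-irrefl refl) tt)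

  rank : Fin m → Fin m
  rank a = fromℕ< (rank<m a)

  rank-mono : ∀ {a b} → h a < h b → rank a <ᶠ rank b
  rank-mono {a} {b} lt = subst₂ _<_ (sym (toℕ-fromℕ< (rank<m a))) (sym (toℕ-fromℕ< (rank<m b)))
    (count-mono-< (below? a) (below? b) (λ _ lt′ → <-trans lt′ lt) a (<-irrefl refl) lt)

  rank-reflects : ∀ {a b} → rank a <ᶠ rank b → h a < h b
  rank-reflects {a} {b} lt = ≰⇒> λ ge → <⇒≱ (subst₂ _<_ (toℕ-fromℕ< (rank<m a)) (toℕ-fromℕ< (rank<m b)) lt)
    (count-mono (below? b) (below? a) (λ _ lt′ → <-≤-trans lt′ ge))

  rank-injective : (∀ {a b} → h a ≡ h b → a ≡ b) → ∀ {a b} → rank a ≡ rank b → a ≡ b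
  rank-injective h-inj {a} {b} eq with <-cmp (h a) (h b)
  ... | tri< lt _ _ = contradiction (cong toℕ eq) (<⇒≢ (rank-mono lt))
  ... | tri≈ _ ha≡hb _ = h-inj ha≡hb
  ... | tri> _ _ gt = contradiction (cong toℕ (sym eq)) (<⇒≢ (rank-mono gt))

lookup-unique : ∀ {A : Set} {xs : List A} → Unique xs → ∀ {i j} → lookupˡ xs i ≡ lookupˡ xs j → i ≡ j
lookup-unique (_ ∷ _) {zero} {zero} _ = refl
lookup-unique (x∉xs ∷ _) {zero} {suc j} eq = contradiction eq (All.lookup x∉xs (∈-lookup j))
lookup-unique (x∉xs ∷ _) {suc i} {zero} eq = contradiction (sym eq) (All.lookup x∉xs (∈-lookup i))
lookup-unique (_ ∷ uniq) {suc i} {suc j} eq = cong suc (lookup-unique uniq eq)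

module _ {m n : ℕ} (σ : Vec (Fin n) n) where

  standardise : Thinning m n → Vec (Fin m) m
  standardise t = tabulate (rank (toℕ ∘ lookup σ ∘ ⟦ t ⟧))

  standardise-order : ∀ t a b →
    lookup (standardise t) a <ᶠ lookup (standardise t) b ⇔ lookup σ (⟦ t ⟧ a) <ᶠ lookup σ (⟦ t ⟧ b)
  standardise-order t a b = mk⇔
    (rank-reflects h ∘ subst₂ _<ᶠ_ (lookup∘tabulate (rank h) a) (lookup∘tabulate (rank h) b))
    (subst₂ _<ᶠ_ (sym (lookup∘tabulate (rank h) a)) (sym (lookup∘tabulate (rank h) b)) ∘ rank-mono h)
    where h = toℕ ∘ lookup σ ∘ ⟦ t ⟧

  standardise-≼ : ∀ t → standardise t ≼ σ
  standardise-≼ t = ⟦ t ⟧ , (λ a b → ⟦⟧-increasing t) , standardise-order t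

  module _ (σ-perm : IsPerm σ) where

    standardise-perm : ∀ t → IsPerm (standardise t)
    standardise-perm t a b eq = rank-injective (toℕ ∘ lookup σ ∘ ⟦ t ⟧)
      (⟦⟧-injective t ∘ σ-perm _ _ ∘ toℕ-injective)
      (trans (sym (lookup∘tabulate _ a)) (trans eq (lookup∘tabulate _ b)))

    -- The embedding is a thinning by `⟦⟧-full`, and a permutation is determined by the order of its
    -- entries.
    ≼⇒standardise : ∀ π → IsPerm π → π ≼ σ → ∃[ t ] π ≡ standardise t
    ≼⇒standardise π π-perm (e , e-inc , same) with ⟦⟧-full e (e-inc _ _)
    ... | t , t≗e = t , order-determines π (standardise t) π-perm (standardise-perm t) λ a b → mk⇔
      (from (standardise-order t a b) ∘ subst₂ (λ x y → lookup σ x <ᶠ lookup σ y) (sym (t≗e a)) (sym (t≗e b)) ∘ to (same a b))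
      (from (same a b) ∘ subst₂ (λ x y → lookup σ x <ᶠ lookup σ y) (t≗e a) (t≗e b) ∘ to (standardise-order t a b))

    standardise-cong : ∀ t t′ →
      (∀ a b → lookup σ (⟦ t ⟧ a) <ᶠ lookup σ (⟦ t ⟧ b) ⇔ lookup σ (⟦ t′ ⟧ a) <ᶠ lookup σ (⟦ t′ ⟧ b)) →
      standardise t ≡ standardise t′
    standardise-cong t t′ same = order-determines _ _ (standardise-perm t) (standardise-perm t′) λ a b → mk⇔
      (from (standardise-order t′ a b) ∘ to (same a b) ∘ to (standardise-order t a b))
      (from (standardise-order t a b) ∘ from (same a b) ∘ to (standardise-order t′ a b))

    -- Equal patterns make `⟦ t ⟧ a ↦ ⟦ t′ ⟧ a` order-preserving in position and in value, the two
    -- coordinates of `far⇒embedding-unique`.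
    far⇒standardise-injective : (∀ {x y} → x ≢ y → n + 2 ≤ dist σ x y + m) →
      ∀ {t t′} → standardise t ≡ standardise t′ → t ≡ t′
    far⇒standardise-injective far {t} {t′} eq =
      ⟦⟧-faithful t t′ (far⇒embedding-unique horizontal vertical (⟦⟧-injective t) far)
      where
      reflect : ∀ (t : Thinning m n) a b → ⟦ t ⟧ a <ᶠ ⟦ t ⟧ b → a <ᶠ b
      reflect t a b lt with <ᶠ-cmp a b
      ... | tri< a<b _ _ = a<b
      ... | tri≈ _ refl _ = contradiction lt (<-irrefl refl)
      ... | tri> _ _ b<a = contradiction lt (<⇒≯ (⟦⟧-increasing t b<a))
      horizontal : Coordinate ⟦ t ⟧ ⟦ t′ ⟧
      horizontal = record
        { pos = toℕ ; pos-injective = toℕ-injective ; pos<n = toℕ<n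
        ; pos-surjective = λ i i<n → fromℕ< i<n , toℕ-fromℕ< i<n
        ; preserves = λ a b lt → ⟦⟧-increasing t′ (reflect t a b lt)
        ; reflects = λ a b lt → ⟦⟧-increasing t (reflect t′ a b lt) }
      vertical : Coordinate ⟦ t ⟧ ⟦ t′ ⟧
      vertical = record
        { pos = toℕ ∘ lookup σ ; pos-injective = σ-perm _ _ ∘ toℕ-injective ; pos<n = toℕ<n ∘ lookup σ
        ; pos-surjective = λ i i<n → let x , eq′ = injective⇒surjective (lookup σ) (σ-perm _ _) (fromℕ< i<n) in
            x , trans (cong toℕ eq′) (toℕ-fromℕ< i<n)
        ; preserves = λ a b lt → to (standardise-order t′ a b)
            (subst (λ π → lookup π a <ᶠ lookup π b) eq (from (standardise-order t a b) lt))
        ; reflects = λ a b lt → to (standardise-order t a b)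
            (subst (λ π → lookup π a <ᶠ lookup π b) (sym eq) (from (standardise-order t′ a b) lt)) }

    injective⇒patterns : (∀ {t t′} → standardise t ≡ standardise t′ → t ≡ t′) → NumPatterns m σ (n C m)
    injective⇒patterns inj = map standardise (thinnings m n) , Unique.map⁺ inj (thinnings-unique m n) ,
      (λ π → mk⇔ (sound π) (complete π)) , trans (length-map standardise (thinnings m n)) (length-thinnings m n)
      where
      sound : ∀ π → π ∈ map standardise (thinnings m n) → IsPerm π × π ≼ σ
      sound π π∈ with ∈-map⁻ standardise π∈
      ... | t , _ , refl = standardise-perm t , standardise-≼ t
      complete : ∀ π → IsPerm π × π ≼ σ → π ∈ map standardise (thinnings m n)
      complete π (π-perm , π≼σ) with ≼⇒standardise π π-perm π≼σ
      ... | t , refl = ∈-map⁺ standardise (∈-thinnings t)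

    -- Pigeonhole: a coincidence would let every listed pattern be realised without `t₁`, so the
    -- `n C m` patterns and `t₁` would inject into the `n C m` thinnings.
    patterns⇒injective : NumPatterns m σ (n C m) → ∀ {t t′} → standardise t ≡ standardise t′ → ¬ (t ≢ t′)
    patterns⇒injective (L , L-unique , L-complete , |L|) {t₀} {t₁} same t₀≢t₁ =
      1+n≰n (≤-trans (s≤s (≤-reflexive (sym |L|)))
        (≤-trans (injective⇒≤ (disjoint-⊎ (λ (_ : Fin 1) → code t₁) (code ∘ chosen)
                    (λ { {zero} {zero} _ → refl }) (chosen-injective ∘ code-injective)
                    (λ _ i → chosen≢t₁ i ∘ sym ∘ code-injective)))
                 (≤-reflexive (length-thinnings m n))))
      where
      code : Thinning m n → Fin (length (thinnings m n))
      code t = index (∈-thinnings t)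
      code-injective : ∀ {t t′} → code t ≡ code t′ → t ≡ t′
      code-injective {t} {t′} eq = trans (lookup-result (∈-thinnings t))
        (trans (cong (lookupˡ (thinnings m n)) eq) (sym (lookup-result (∈-thinnings t′))))
      _≟ₜ_ : ∀ t t′ → Dec (t ≡ t′)
      t ≟ₜ t′ with code t ≟ᶠ code t′
      ... | yes eq = yes (code-injective eq)
      ... | no neq = no (neq ∘ cong code)
      witness : ∀ i → ∃[ t ] (lookupˡ L i ≡ standardise t × t ≢ t₁)
      witness i with to (L-complete _) (∈-lookup {xs = L} i)
      ... | π-perm , π≼σ with ≼⇒standardise _ π-perm π≼σ
      ... | t , eq with t ≟ₜ t₁
      -- `t₁` is replaced by `t₀`, which has the same pattern.
      ... | yes refl = t₀ , trans eq (sym same) , t₀≢t₁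
      ... | no t≢t₁ = t , eq , t≢t₁
      chosen : Fin (length L) → Thinning m n
      chosen i = proj₁ (witness i)
      chosen≢t₁ : ∀ i → chosen i ≢ t₁
      chosen≢t₁ i = proj₂ (proj₂ (witness i))
      chosen-injective : ∀ {i j} → chosen i ≡ chosen j → i ≡ j
      chosen-injective {i} {j} eq = lookup-unique L-unique
        (trans (proj₁ (proj₂ (witness i))) (trans (cong standardise eq) (sym (proj₁ (proj₂ (witness j))))))

-- Close pairs produce repeated patterns

-- Together with `outside->`: a number outside the interval from `lo` to `hi` cannot tell two
-- members of it apart.
outside-< : ∀ {lo hi p q w} → p ≤ hi → lo ≤ q → w < lo ⊎ hi < w → w < p → w < q
outside-< p≤hi lo≤q (inj₁ w<lo) _ = <-≤-trans w<lo lo≤q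
outside-< p≤hi lo≤q (inj₂ hi<w) w<p = contradiction (<-trans hi<w w<p) (≤⇒≯ p≤hi)

outside-> : ∀ {lo hi p q w} → lo ≤ p → q ≤ hi → w < lo ⊎ hi < w → p < w → q < w
outside-> lo≤p q≤hi (inj₁ w<lo) p<w = contradiction (<-trans p<w w<lo) (≤⇒≯ lo≤p)
outside-> lo≤p q≤hi (inj₂ hi<w) _ = ≤-<-trans q≤hi hi<w

-- Once everything in the rows and columns between the close entries i and j is
-- dropped, i and j become interchangeable.
module Collision {n m : ℕ} (σ : Vec (Fin n) n) (σ-perm : IsPerm σ) {i j : Fin n} (i<j : i <ᶠ j)
  {lo hi : ℕ} (lo<hi : lo < hi)
  (ends : (toℕ (lookup σ i) ≡ lo × toℕ (lookup σ j) ≡ hi) ⊎ (toℕ (lookup σ i) ≡ hi × toℕ (lookup σ j) ≡ lo))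
  (close : (toℕ j ∸ toℕ i) + (hi ∸ suc lo) + suc m ≤ n) where

  val : Fin n → ℕ
  val x = toℕ (lookup σ x)

  val-injective : ∀ {x y} → val x ≡ val y → x ≡ y
  val-injective = σ-perm _ _ ∘ toℕ-injective

  lo≤val : lo ≤ val i × lo ≤ val j
  lo≤val = [ (λ (vi , vj) → ≤-reflexive (sym vi) , subst (lo ≤_) (sym vj) (<⇒≤ lo<hi))
           , (λ (vi , vj) → subst (lo ≤_) (sym vi) (<⇒≤ lo<hi) , ≤-reflexive (sym vj)) ]′ ends

  val≤hi : val i ≤ hi × val j ≤ hi
  val≤hi = [ (λ (vi , vj) → subst (_≤ hi) (sym vi) (<⇒≤ lo<hi) , ≤-reflexive vj)
           , (λ (vi , vj) → ≤-reflexive vi , subst (_≤ hi) (sym vj) (<⇒≤ lo<hi)) ]′ ends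

  -- `InColumns` is half-open: it contains `j` but not `i`, so `i` may be selected and `j` may not.
  InColumns InRows Clear : Fin n → Set
  InColumns x = i <ᶠ x × toℕ x ≤ toℕ j
  InRows x = lo < val x × val x < hi
  Clear x = ¬ (InColumns x ⊎ InRows x)

  columns? : ∀ x → Dec (InColumns x)
  columns? x = (i <?ᶠ x) ×-dec (toℕ x ≤? toℕ j)

  rows? : ∀ x → Dec (InRows x)
  rows? x = (lo <? val x) ×-dec (val x <? hi)

  clear? : ∀ x → Dec (Clear x)
  clear? x = ¬? (columns? x ⊎-dec rows? x)

  clear-i : Clear i
  clear-i (inj₁ (i<i , _)) = <-irrefl refl i<i
  clear-i (inj₂ (lo<v , v<hi)) =
    [ (λ (vi , _) → <-irrefl (sym vi) lo<v) , (λ (vi , _) → <-irrefl vi v<hi) ]′ ends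

  count-columns : count columns? ≤ toℕ j ∸ toℕ i
  count-columns = count-interval columns? toℕ toℕ-injective (suc (toℕ i)) _
    λ { x (i<x , x≤j) → i<x , s≤s (≤-trans x≤j (≤-reflexive (sym (m+[n∸m]≡n (<⇒≤ i<j))))) }

  count-rows : count rows? ≤ hi ∸ suc lo
  count-rows = count-interval rows? val val-injective (suc lo) _
    λ { x (lo<v , v<hi) → lo<v , <-≤-trans v<hi (≤-reflexive (sym (m+[n∸m]≡n lo<hi))) }

  enough-clear : suc m ≤ count clear?
  enough-clear = +-cancelˡ-≤ ((toℕ j ∸ toℕ i) + (hi ∸ suc lo)) _ _ (begin
    (toℕ j ∸ toℕ i) + (hi ∸ suc lo) + suc m          ≤⟨ close ⟩
    n                                                ≡⟨ count-everything n ⟨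
    count (everything {n})                           ≤⟨ count-subadditive everything _ clear? cover ⟩
    count (λ x → columns? x ⊎-dec rows? x) + count clear?
      ≤⟨ +-monoˡ-≤ (count clear?) (count-subadditive (λ x → columns? x ⊎-dec rows? x) columns? rows? (λ _ → λ s → s)) ⟩
    count columns? + count rows? + count clear?      ≤⟨ +-monoˡ-≤ (count clear?) (+-mono-≤ count-columns count-rows) ⟩
    (toℕ j ∸ toℕ i) + (hi ∸ suc lo) + count clear?   ∎)
    where
    open ≤-Reasoning
    cover : ∀ x → ⊤ → (InColumns x ⊎ InRows x) ⊎ Clear x
    cover x _ with columns? x ⊎-dec rows? x
    ... | yes s = inj₁ s
    ... | no ¬s = inj₂ ¬s

  clear≢j : ∀ {x} → Clear x → x ≢ j
  clear≢j clear refl = clear (inj₁ (i<j , ≤-refl))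

  on-end : ∀ {x} → val x ≡ lo ⊎ val x ≡ hi → x ≡ i ⊎ x ≡ j
  on-end = [ (λ (vi , vj) → [ (λ v → inj₁ (hits v vi)) , (λ v → inj₂ (hits v vj)) ]′)
           , (λ (vi , vj) → [ (λ v → inj₂ (hits v vj)) , (λ v → inj₁ (hits v vi)) ]′) ]′ ends
    where
    hits : ∀ {x y w} → val x ≡ w → val y ≡ w → x ≡ y
    hits p q = val-injective (trans p (sym q))

  -- The values `lo` and `hi` belong to `i` and `j` alone, and `j` is not clear.
  clear⇒outside : ∀ {x} → Clear x → x ≢ i → val x < lo ⊎ hi < val x
  clear⇒outside {x} clear x≢i with <-cmp (val x) lo | <-cmp (val x) hi
  ... | tri< lt _ _ | _ = inj₁ lt
  ... | _ | tri> _ _ gt = inj₂ gt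
  ... | tri> _ _ gt | tri< lt _ _ = contradiction (inj₂ (gt , lt)) clear
  ... | tri≈ _ eq _ | _ = contradiction (on-end (inj₁ eq)) [ x≢i , clear≢j clear ]′
  ... | _ | tri≈ _ eq _ = contradiction (on-end (inj₂ eq)) [ x≢i , clear≢j clear ]′

  module _ (t : Thinning (suc m) n) (clear-t : ∀ a → Clear (⟦ t ⟧ a)) (r : Fin (suc m)) (tr≡i : ⟦ t ⟧ r ≡ i) where

    left-of-r : ∀ {a} → a <ᶠ r → ⟦ t ⟧ a <ᶠ j
    left-of-r a<r = <-trans (subst (⟦ t ⟧ _ <ᶠ_) tr≡i (⟦⟧-increasing t a<r)) i<j

    right-of-r : ∀ {a} → r <ᶠ a → j <ᶠ ⟦ t ⟧ a
    right-of-r {a} r<a = ≰⇒> λ ta≤j → clear-t a (inj₁ (subst (_<ᶠ ⟦ t ⟧ a) tr≡i (⟦⟧-increasing t r<a) , ta≤j))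

    moved : Fin (suc m) → Fin n
    moved a with a ≟ᶠ r
    ... | yes _ = j
    ... | no _ = ⟦ t ⟧ a

    moved-r : moved r ≡ j
    moved-r with r ≟ᶠ r
    ... | yes _ = refl
    ... | no r≢r = contradiction refl r≢r

    -- No selected entry other than `i` lies in the columns from `i` to `j`, so `j` can take the
    -- place of `i`.
    moved-increasing : ∀ {a b} → a <ᶠ b → moved a <ᶠ moved b
    moved-increasing {a} {b} a<b with a ≟ᶠ r | b ≟ᶠ r
    ... | yes refl | yes refl = contradiction a<b (<-irrefl refl)
    ... | yes refl | no _ = right-of-r a<b
    ... | no _ | yes refl = left-of-r a<b
    ... | no _ | no _ = ⟦⟧-increasing t a<b

    t-outside : ∀ {a} → a ≢ r → val (⟦ t ⟧ a) < lo ⊎ hi < val (⟦ t ⟧ a)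
    t-outside {a} a≢r = clear⇒outside (clear-t a) λ ta≡i → a≢r (⟦⟧-injective t (trans ta≡i (sym tr≡i)))

    -- Every other selected value lies outside the interval from `lo` to `hi`, to which the values
    -- of `i` and `j` both belong.
    moved-order : ∀ a b → val (⟦ t ⟧ a) < val (⟦ t ⟧ b) ⇔ val (moved a) < val (moved b)
    moved-order a b with a ≟ᶠ r | b ≟ᶠ r
    ... | yes refl | yes refl = mk⇔ (λ lt → contradiction lt (<-irrefl refl)) (λ lt → contradiction lt (<-irrefl refl))
    ... | yes refl | no b≢r rewrite tr≡i = mk⇔
            (outside-> (proj₁ lo≤val) (proj₂ val≤hi) (t-outside b≢r))
            (outside-> (proj₂ lo≤val) (proj₁ val≤hi) (t-outside b≢r))
    ... | no a≢r | yes refl rewrite tr≡i = mk⇔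
            (outside-< (proj₁ val≤hi) (proj₂ lo≤val) (t-outside a≢r))
            (outside-< (proj₂ val≤hi) (proj₁ lo≤val) (t-outside a≢r))
    ... | no _ | no _ = mk⇔ (λ lt → lt) (λ lt → lt)

    collision′ : ∃[ t′ ] (t ≢ t′ × standardise σ t ≡ standardise σ t′)
    collision′ with ⟦⟧-full moved moved-increasing
    ... | t′ , t′≗moved = t′ ,
      (λ { refl → <⇒≢ i<j (cong toℕ (trans (sym tr≡i) (trans (t′≗moved r) moved-r))) }) ,
      standardise-cong σ σ-perm t t′ λ a b →
        subst₂ (λ x y → val (⟦ t ⟧ a) < val (⟦ t ⟧ b) ⇔ val x < val y) (sym (t′≗moved a)) (sym (t′≗moved b)) (moved-order a b)

  collision : ∃[ t ] ∃[ t′ ] (t ≢ t′ × standardise σ t ≡ standardise {suc m} σ t′)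
  collision with select-through clear? m enough-clear i clear-i
  ... | t , clear-t , r , tr≡i = t , collision′ t clear-t r tr≡i

-- The distance is one more than the number of columns and rows to be dropped, and `near` is strict:
-- these two units turn `n + 2` into `n`.
shrink : ∀ {n m a b lo hi} → a < b → lo < hi → ∣ a - b ∣ + ∣ lo - hi ∣ + m < n + 2 → (b ∸ a) + (hi ∸ suc lo) + m ≤ n
shrink {n} {m} {a} {b} {lo} {hi} a<b lo<hi near = s≤s⁻¹ (s≤s⁻¹ (begin
  suc (suc ((b ∸ a) + (hi ∸ suc lo) + m)) ≡⟨ cong (λ c → suc (c + m)) (+-suc (b ∸ a) (hi ∸ suc lo)) ⟨
  suc ((b ∸ a) + suc (hi ∸ suc lo) + m)   ≡⟨ cong₂ (λ c d → suc (c + d + m)) (m≤n⇒∣m-n∣≡n∸m (<⇒≤ a<b))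
                                              (trans (m≤n⇒∣m-n∣≡n∸m (<⇒≤ lo<hi)) (+-∸-assoc 1 lo<hi)) ⟨
  suc (∣ a - b ∣ + ∣ lo - hi ∣ + m)       ≤⟨ near ⟩
  n + 2                                   ≡⟨ +-comm n 2 ⟩
  suc (suc n)                             ∎))
  where open ≤-Reasoning

close⇒collision : ∀ {n m} (σ : Vec (Fin n) n) → IsPerm σ → ∀ {i j} → i <ᶠ j → dist σ i j + suc m < n + 2 →
  ∃[ t ] ∃[ t′ ] (t ≢ t′ × standardise σ t ≡ standardise {suc m} σ t′)
close⇒collision {n} {m} σ σ-perm {i} {j} i<j near with <-cmp (toℕ (lookup σ i)) (toℕ (lookup σ j))
... | tri< lt _ _ = Collision.collision σ σ-perm i<j lt (inj₁ (refl , refl)) (shrink i<j lt near)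
... | tri≈ _ eq _ = contradiction (cong toℕ (σ-perm _ _ (toℕ-injective eq))) (<⇒≢ i<j)
... | tri> _ _ gt = Collision.collision σ σ-perm i<j gt (inj₂ (refl , refl)) (shrink i<j gt
        (subst (λ d → ∣ toℕ i - toℕ j ∣ + d + suc m < n + 2) (∣-∣-comm (toℕ (lookup σ i)) (toℕ (lookup σ j))) near))

-- br hides its list of pair distances in a where clause; unification recovers it.
pair-distances : ∀ {n} (σ : Vec (Fin n) n) → Σ (Fin n → Fin n → List ℕ) λ ds →
  br σ ≡ foldr _⊓_ (2 * n) (concatMap (λ i → concatMap (λ j → ds i j) (allFin n)) (allFin n))
pair-distances σ = _ , refl

pair-distances⁺ : ∀ {n} (σ : Vec (Fin n) n) {b} → (∀ {i j} → i <ᶠ j → b ≤ dist σ i j) →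
  ∀ i j → All (b ≤_) (proj₁ (pair-distances σ) i j)
pair-distances⁺ σ bound i j with i <?ᶠ j
... | yes i<j = bound i<j ∷ []
... | no _ = []

pair-distances⁻ : ∀ {n} (σ : Vec (Fin n) n) {b i j} → i <ᶠ j →
  All (b ≤_) (proj₁ (pair-distances σ) i j) → b ≤ dist σ i j
pair-distances⁻ σ {i = i} {j} i<j bounds with i <?ᶠ j
pair-distances⁻ σ i<j (bound ∷ []) | yes _ = bound
... | no i≮j = contradiction i<j i≮j

-- Breadth as a minimum: bounds through the fold

foldr-⊓⁺ : ∀ {b d} xs → b ≤ d → All (b ≤_) xs → b ≤ foldr _⊓_ d xs
foldr-⊓⁺ [] b≤d [] = b≤d
foldr-⊓⁺ (x ∷ xs) b≤d (b≤x ∷ b≤xs) = ⊓-glb b≤x (foldr-⊓⁺ xs b≤d b≤xs)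

foldr-⊓⁻ : ∀ {b d} xs → b ≤ foldr _⊓_ d xs → All (b ≤_) xs
foldr-⊓⁻ [] _ = []
foldr-⊓⁻ (x ∷ xs) b≤ = ≤-trans b≤ (m⊓n≤m x _) ∷ foldr-⊓⁻ xs (≤-trans b≤ (m⊓n≤n x _))

-- The bound `b ≤ 2 * n` concerns the start value of the fold.
≤br : ∀ {n} (σ : Vec (Fin n) n) {b} → b ≤ 2 * n → (∀ {i j} → i <ᶠ j → b ≤ dist σ i j) → b ≤ br σ
≤br σ b≤2n bound = foldr-⊓⁺ _ b≤2n (All.concat⁺ (All.map⁺ (All.tabulate⁺ λ i →
  All.concat⁺ (All.map⁺ (All.tabulate⁺ λ j → pair-distances⁺ σ bound i j)))))

≤br⇒≤dist : ∀ {n} (σ : Vec (Fin n) n) {b} → b ≤ br σ → ∀ {i j} → i <ᶠ j → b ≤ dist σ i j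
≤br⇒≤dist σ b≤br {i} {j} i<j = pair-distances⁻ σ i<j
  (All.tabulate⁻ (All.map⁻ (All.concat⁻ (All.tabulate⁻ (All.map⁻ (All.concat⁻ (foldr-⊓⁻ _ b≤br))) i))) j)

dist-comm : ∀ {n} (σ : Vec (Fin n) n) i j → dist σ i j ≡ dist σ j i
dist-comm σ i j = cong₂ _+_ (∣-∣-comm (toℕ i) (toℕ j)) (∣-∣-comm (toℕ (lookup σ i)) (toℕ (lookup σ j)))

≤br⇒≤dist-≢ : ∀ {n} (σ : Vec (Fin n) n) {b} → b ≤ br σ → ∀ {i j} → i ≢ j → b ≤ dist σ i j
≤br⇒≤dist-≢ σ {b} b≤br {i} {j} i≢j with <ᶠ-cmp i j
... | tri< lt _ _ = ≤br⇒≤dist σ b≤br lt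
... | tri≈ _ eq _ = contradiction eq i≢j
... | tri> _ _ gt = subst (b ≤_) (dist-comm σ j i) (≤br⇒≤dist σ b≤br gt)

complement-bound : ∀ {n k} d → k ≤ n → (n + 2 ≤ d + (n ∸ k)) ⇔ (k + 2 ≤ d)
complement-bound {n} {k} d k≤n = mk⇔
  (λ le → +-cancelˡ-≤ (n ∸ k) _ _ (subst₂ _≤_ n+2≡ (+-comm d (n ∸ k)) le))
  (λ le → subst₂ _≤_ (sym n+2≡) (+-comm (n ∸ k) d) (+-monoʳ-≤ (n ∸ k) le))
  where
  n+2≡ : n + 2 ≡ (n ∸ k) + (k + 2)
  n+2≡ = trans (cong (_+ 2) (sym (m∸n+n≡m k≤n))) (+-assoc (n ∸ k) k 2)

-- Positivity of `m` leaves a place in the pattern for the close entry that is exchanged.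
patterns⇒far : ∀ {n m} (σ : Vec (Fin n) n) → IsPerm σ → 0 < m → NumPatterns m σ (n C m) →
  ∀ {i j} → i <ᶠ j → n + 2 ≤ dist σ i j + m
patterns⇒far {m = suc m} σ σ-perm _ patterns i<j = ≮⇒≥ λ near →
  let t , t′ , t≢t′ , same = close⇒collision σ σ-perm i<j near in
  patterns⇒injective σ σ-perm patterns same t≢t′

theorem2p25 : (n k : ℕ) → 1 ≤ k → k < n →
    (σ : Vec (Fin n) n) → IsPerm σ →
    Prolific k σ ⇔ (k + 2 ≤ br σ)
theorem2p25 n k 1≤k k<n σ σ-perm = mk⇔
  (λ prolific → ≤br σ k+2≤2n λ {i} {j} i<j → to (complement-bound (dist σ i j) (<⇒≤ k<n))
    (patterns⇒far σ σ-perm (m<n⇒0<n∸m k<n) (subst (NumPatterns (n ∸ k) σ) nCk prolific) i<j))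
  (λ k+2≤br → subst (NumPatterns (n ∸ k) σ) (sym nCk)
    (injective⇒patterns σ σ-perm (far⇒standardise-injective σ σ-perm λ {x} {y} x≢y →
      from (complement-bound (dist σ x y) (<⇒≤ k<n)) (≤br⇒≤dist-≢ σ k+2≤br x≢y))))
  where
  -- Prolificity counts choices of `k` deleted entries, thinnings those of `n ∸ k` kept ones.
  nCk : n C k ≡ n C (n ∸ k)
  nCk = nCk≡nC[n∸k] (<⇒≤ k<n)
  -- The fold in `br` starts at `2 * n`, which must itself reach `k + 2`.
  k+2≤2n : k + 2 ≤ 2 * n
  k+2≤2n = begin
    k + 2       ≡⟨ +-suc k 1 ⟩
    suc k + 1   ≤⟨ +-mono-≤ k<n (≤-trans 1≤k (<⇒≤ k<n)) ⟩
    n + n       ≡⟨ cong (n +_) (+-identityʳ n) ⟨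
    2 * n       ∎
    where open ≤-Reasoning
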